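{- Let $n\ge 0$, let $\sigma\in I_n$, let $p\in[1,n]$ and let $k\ge 1$ be an integer. If $\Theta^k(\sigma)_p\le k$, then $\Theta^{k-1}(\sigma)_p=\Theta^k(\sigma)_p$.
   Context: For integers $a\le b$, $[a,b]=\{i\in\mathbb Z: a\le i\le b\}$. $I_n$ is the set of inversion sequences of length $n$, i.e. integer sequences $\sigma=(\sigma_1,\ldots,\sigma_n)$ with $0\le\sigma_i<i$ for every $i\in[1,n]$. For a finite integer sequence $\sigma$ of length $n$, $\Theta(\sigma)$ is the sequence of length $n$ defined by $\Theta(\sigma)_i=\#\{j<i:\sigma_j<\sigma_i\}$. $\Theta^k$ denotes the $k$-fold iterate of $\Theta$, with $\Theta^0$ the identity. -}

module Defs where

open import Data.Fin.Base as Fin using (Fin; toℕ)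
import Data.Fin.Properties as Fin
open import Data.Integer.Base as ℤ using (ℤ; +_; 0ℤ)
import Data.Integer.Properties as ℤ
open import Data.List.Base using (allFin; filter; length)
open import Data.Nat.Base using (ℕ; suc)
open import Data.Product.Base using (_×_)
open import Data.Vec.Functional using (Vector)
open import Function.Endo.Propositional using (_^_)
open import Relation.Nullary.Decidable using (_×-dec_)

-- Positions are numbered from 0 by Fin n, so i : Fin n is the position
-- suc (toℕ i) ∈ [1,n], and σᵢ < i reads σ i < + suc (toℕ i).
IsInversionSequence : ∀ {n} → Vector ℤ n → Set
IsInversionSequence σ = ∀ i → 0ℤ ℤ.≤ σ i × σ i ℤ.< + suc (toℕ i)

Θ : ∀ {n} → Vector ℤ n → Vector ℤ n
Θ {n} σ i = + length (filter (λ j → (j Fin.<? i) ×-dec (σ j ℤ.<? σ i)) (allFin n))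

Θ^ : ∀ {n} → ℕ → Vector ℤ n → Vector ℤ n
Θ^ {n} k = _^_ (Vector ℤ n) Θ k

{-# OPTIONS --safe #-}

-- Inversion sequences satisfy τ ≤ Θ τ pointwise, because the first τ_p entries
-- are all smaller than τ_p. Induct on k and suppose a = Θ^k(σ)_p < Θ^{k+1}(σ)_p ≤ k + 1.
-- Then a ≤ k. If k = 0, then a = 0 and no entry of σ is smaller, so Θ(σ)_p = 0 = a.
-- If k > 0, the induction hypothesis says that the entry at p, and every entry of
-- Θ^k(σ) smaller than a, already had the same value in Θ^{k-1}(σ). Hence
-- Θ^{k+1}(σ)_p counts no more entries than Θ^k(σ)_p = a, a contradiction.
module Submission where

open import Defs
open import Data.Fin.Base as Fin using (Fin; toℕ)
import Data.Fin.Properties as Fin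
open import Data.Integer.Base as ℤ using (ℤ; +_; +≤+; +<+)
import Data.Integer.Properties as ℤ
open import Data.List.Base using (allFin; filter; length; tabulate)
open import Data.List.Properties using (filter-accept)
open import Data.List.Relation.Binary.Sublist.Propositional using (⊆-refl)
open import Data.List.Relation.Binary.Sublist.Propositional.Properties
  using (filter⁺; length-mono-≤)
open import Data.Nat.Base as ℕ using (ℕ; zero; suc; _∸_; z≤n; s≤s; s≤s⁻¹; s<s; s<s⁻¹; z<s)
import Data.Nat.Properties as ℕ
open import Data.Product.Base using (_,_; proj₁; proj₂; map₂)
open import Data.Vec.Functional using (Vector)
open import Function.Base using (_∘_)
open import Level using (Level)
open import Relation.Binary.PropositionalEquality using (_≡_; refl; sym; subst₂)
open import Relation.Nullary.Decidable using (yes; no)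
open import Relation.Nullary.Negation using (¬_; contradiction)
open import Relation.Unary using (Pred; Decidable)

private
  variable
    a p : Level
    A : Set a
    P : Pred A p

≤-length-filter-tabulate : (P? : Decidable P) {n : ℕ} (f : Fin n → A) {m : ℕ} → m ℕ.≤ n →
  (∀ i → toℕ i ℕ.< m → P (f i)) → m ℕ.≤ length (filter P? (tabulate f))
≤-length-filter-tabulate P? f z≤n h = z≤n
≤-length-filter-tabulate P? f (s≤s m≤n) h
  rewrite filter-accept P? {xs = tabulate (f ∘ Fin.suc)} (h Fin.zero z<s) =
  s≤s (≤-length-filter-tabulate P? (f ∘ Fin.suc) m≤n (λ i → h (Fin.suc i) ∘ s<s))

length-filter-tabulate-≤ : (P? : Decidable P) {n : ℕ} (f : Fin n → A) (m : ℕ) →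
  (∀ i → P (f i) → toℕ i ℕ.< m) → length (filter P? (tabulate f)) ℕ.≤ m
length-filter-tabulate-≤ P? {zero} f m h = z≤n
length-filter-tabulate-≤ P? {suc n} f m h with P? (f Fin.zero)
-- Tail indices are one lower than positions in `f`, so the bound `m` survives with room to spare.
length-filter-tabulate-≤ P? {suc n} f m h | no _ =
  length-filter-tabulate-≤ P? (f ∘ Fin.suc) m (λ i → ℕ.<-trans (ℕ.n<1+n _) ∘ h (Fin.suc i))
length-filter-tabulate-≤ P? {suc n} f zero h | yes Pf0 = contradiction (h Fin.zero Pf0) λ ()
length-filter-tabulate-≤ P? {suc n} f (suc m) h | yes _ =
  s≤s (length-filter-tabulate-≤ P? (f ∘ Fin.suc) m (λ i → s<s⁻¹ ∘ h (Fin.suc i)))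

Θ-≤ : ∀ {n} {τ : Vector ℤ n} (i : Fin n) (m : ℕ) →
  (∀ j → j Fin.< i → τ j ℤ.< τ i → toℕ j ℕ.< m) → Θ τ i ℤ.≤ + m
Θ-≤ {n} i m h = +≤+ (length-filter-tabulate-≤ _ {n} _ m (λ j (j<i , τj<τi) → h j j<i τj<τi))

Θ-isInversionSequence : ∀ {n} (τ : Vector ℤ n) → IsInversionSequence (Θ τ)
Θ-isInversionSequence τ i =
  +≤+ z≤n , +<+ (s≤s (ℤ.drop‿+≤+ (Θ-≤ {τ = τ} i (toℕ i) (λ _ j<i _ → j<i))))

Θ^-isInversionSequence : ∀ {n} {σ : Vector ℤ n} → IsInversionSequence σ →
  ∀ k → IsInversionSequence (Θ^ k σ)
Θ^-isInversionSequence σ-inv zero    = σ-inv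
Θ^-isInversionSequence σ-inv (suc k) = Θ-isInversionSequence _

≤-Θ : ∀ {n} {τ : Vector ℤ n} → IsInversionSequence τ → ∀ i → τ i ℤ.≤ Θ τ i
≤-Θ {n} {τ} τ-inv i with τ i | τ-inv i
... | + s | _ , +<+ s≤i =
  -- A position `j < s` precedes `i` since `s ≤ i`, and its entry is at most `j`, hence below `s`.
  +≤+ (≤-length-filter-tabulate _ _ (ℕ.≤-trans (s≤s⁻¹ s≤i) (ℕ.<⇒≤ (Fin.toℕ<n i))) λ j j<s →
    ℕ.<-≤-trans j<s (s≤s⁻¹ s≤i) , ℤ.<-≤-trans (proj₂ (τ-inv j)) (+≤+ j<s))

-- The positions counted for `τ` are among those counted for `υ`; values are compared only within
-- each sequence.
Θ-mono : ∀ {n} {τ υ : Vector ℤ n} (i : Fin n) →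
  (∀ j → τ j ℤ.< τ i → υ j ℤ.< υ i) → Θ τ i ℤ.≤ Θ υ i
Θ-mono {n} i h = +≤+ (length-mono-≤
  (filter⁺ _ _ (λ { refl → map₂ (h _) }) (⊆-refl {x = allFin n})))

-- Mutual induction: stability at `k` rests on `Θ^-≮` at `k`, which at `suc k` rests on stability at
-- `k`.
Θ^-stable : ∀ {n} {σ : Vector ℤ n} → IsInversionSequence σ → ∀ k i →
  Θ^ (suc k) σ i ℤ.≤ + suc k → Θ^ k σ i ≡ Θ^ (suc k) σ i
Θ^-≮ : ∀ {n} {σ : Vector ℤ n} → IsInversionSequence σ → ∀ k i →
  Θ^ k σ i ℤ.≤ + k → ¬ (Θ^ k σ i ℤ.< Θ^ (suc k) σ i)

Θ^-stable {σ = σ} σ-inv k i ≤k with Θ^ k σ i ℤ.<? Θ^ (suc k) σ i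
-- Strictness lowers the bound from `suc k` to `k`.
... | yes lt = contradiction lt (Θ^-≮ σ-inv k i (ℤ.i<j⇒i≤pred[j] (ℤ.<-≤-trans lt ≤k)))
... | no ≮ = ℤ.≤-antisym (≤-Θ (Θ^-isInversionSequence σ-inv k) i) (ℤ.≮⇒≥ ≮)

-- An entry below `σ i ≤ 0` would be negative, so the count is 0.
Θ^-≮ {σ = σ} σ-inv zero i σi≤0 lt =
  ℤ.<⇒≱ lt (ℤ.≤-trans (Θ-≤ {τ = σ} i 0 λ j _ σj<σi →
    contradiction (proj₁ (σ-inv j)) (ℤ.<⇒≱ (ℤ.<-≤-trans σj<σi σi≤0))) (proj₁ (σ-inv i)))
-- Here `j<i` compares values, not positions: it puts the entry at `j` below `suc k` too, so both
-- entries are stable.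
Θ^-≮ {σ = σ} σ-inv (suc k) i ≤k lt = ℤ.<⇒≱ lt (Θ-mono i λ j j<i →
  subst₂ ℤ._<_ (sym (Θ^-stable σ-inv k j (ℤ.≤-trans (ℤ.<⇒≤ j<i) ≤k)))
    (sym (Θ^-stable σ-inv k i ≤k)) j<i)

proposition3p4 : ∀ (n : ℕ) (σ : Vector ℤ n) → IsInversionSequence σ →
    ∀ (p : Fin n) (k : ℕ) → 1 ℕ.≤ k →
    Θ^ k σ p ℤ.≤ + k → Θ^ (k ∸ 1) σ p ≡ Θ^ k σ p
proposition3p4 n σ σ-inv p (suc k) 1≤k = Θ^-stable σ-inv k p
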